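{- Let $G$ be a digraph rooted at $v$ and let $u$ be an arbitrary vertex of $G$. Put $D=\mathsf{dom}_G(u)$. Then $$\kappa(G)=\kappa\big(\mathsf{root}_u(G[D])\big)\cdot\kappa\big(G(D\to u)\big).$$
   Context: Digraphs are finite directed graphs without loops; parallel edges are allowed. An arborescence of a digraph $G=(V,E)$ is a subdigraph $A$ spanning all of $V$ with a root vertex from which every vertex is reachable along a unique directed path in $A$ (a rooted directed spanning tree with edges directed away from the root). Arborescences are identified with their edge sets. Let $\mathsf{arb}(G)$ be the set of all arborescences of $G$ (over all roots). Each edge carries a label, which is a polynomial variable; distinct edges of the original digraph $G$ have distinct labels (the edge $e$ itself is used as the variable), and edges of digraphs derived from $G$ keep the label of the edge of $G$ they come from. The Kirchhoff polynomial of a digraph is $\kappa(G)=\sum_{A\in\mathsf{arb}(G)}\prod_{e\in A}e$, where $e$ stands for its label; for a one-vertex digraph $\kappa(G)=1$. $G$ is rooted at $v$ if $v$ has no incoming edges and every other vertex is reachable from $v$ by a directed path. If $G$ is rooted at $v$, a vertex $u$ dominates a vertex $w$ if all directed paths from $v$ to $w$ go through $u$; $\mathsf{dom}_G(u)$ denotes the set of all vertices dominated by $u$ (so $u\in\mathsf{dom}_G(u)$). $G[D]$ is the subdigraph induced by $D\subseteq V$. For a digraph $F$ and $u\in V(F)$, $\mathsf{root}_u(F)$ is the digraph obtained from $F$ by removing all edges incoming to $u$. For $S\subseteq V$ and $u\in S$, the contracted digraph $G(S\to u)$ is obtained from $G$ by: (1) removing all edges $xy$ with $x\in V\setminus S$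 and $y\in S\setminus\{u\}$; (2) removing all edges $xy$ with $x,y\in S$; (3) contracting all vertices of $S$ into the single vertex $u$ (so each edge $sz$ with $s\in S$, $z\notin S$ becomes an edge $uz$ with the same label, possibly creating parallel edges, and edges $zu$ with $z\notin S$ are kept). -}

module Defs where

open import Data.Bool.Base using (true; if_then_else_)
open import Data.Fin.Base using (Fin)
open import Data.Fin.Properties using (_≟_; any?; all?)
open import Data.Fin.Subset
  using (Subset; inside; outside; _∈_; _∉_; _⊆_; _─_; _-_; _∪_; ⁅_⁆)
open import Data.Fin.Subset.Properties
  using (_∈?_; _⊆?_; x∈p∪q⁺; x∈⁅x⁆; x∈p∧x∉q⇒x∈p─q; x∈p∧x≢y⇒x∈p-y; p─q⊆p)
open import Data.Integer.Base as ℤ using (ℤ; 0ℤ; 1ℤ)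
open import Data.List.Base as List
  using (List; []; _∷_; _++_; _∷ʳ_; map; foldr; filter; allFin; cartesianProductWith)
open import Data.List.Membership.Propositional using () renaming (_∈_ to _∈ˡ_)
open import Data.List.Membership.Propositional.Properties using (∈-allFin)
import Data.List.Membership.DecPropositional as DecMembership
open import Data.List.Properties using (∷ʳ-injectiveʳ)
open import Data.List.Relation.Unary.Any using (here; there)
open import Data.List.Reverse using (Reverse; []; _∶_∶ʳ_; reverseView)
open import Data.Nat.Base as ℕ using (ℕ; zero; suc)
import Data.Nat.Properties as ℕₚ
open import Data.Product.Base using (Σ; Σ-syntax; ∃; ∃-syntax; _×_; _,_; proj₁; proj₂)
open import Data.Product using (∃!)
open import Data.Sum.Base using (_⊎_; inj₁; inj₂)
open import Data.Vec.Base as Vec using (Vec; []; _∷_; tabulate; lookup; _[_]≔_)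
open import Data.Vec.Properties
  using (≡-dec; lookup∘tabulate; []=⇒lookup; lookup⇒[]=)
open import Function.Base using (_∘_)
open import Relation.Binary.PropositionalEquality
  using (_≡_; _≢_; refl; sym; trans; cong; subst)
open import Relation.Nullary using (Dec; yes; no; ¬_; does; contradiction)
open import Relation.Nullary.Decidable
  using (map′; _×-dec_; _⊎-dec_; _→-dec_; ¬?; dec-true)
open import Relation.Unary using (Decidable)

------------------------------------------------------------------------
-- Polynomials over ℤ in the variables indexed by Fin m

-- A monomial is its vector of exponents.
Monomial : ℕ → Set
Monomial m = Vec ℕ m

-- A polynomial is a finite formal sum of terms, in which a monomial may occur
-- repeatedly; two polynomials are equal (_≈_) when all coefficients agree.
Poly : ℕ → Set
Poly m = List (ℤ × Monomial m)

module _ {m : ℕ} where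

  infix  4 _≈_
  infixl 6 _+ᵖ_
  infixl 7 _*ᵖ_

  coeff : Poly m → Monomial m → ℤ
  coeff []            M = 0ℤ
  coeff ((c , N) ∷ p) M =
    (if does (≡-dec ℕₚ._≟_ N M) then c else 0ℤ) ℤ.+ coeff p M

  _≈_ : Poly m → Poly m → Set
  p ≈ q = ∀ M → coeff p M ≡ coeff q M

  0ᵖ 1ᵖ : Poly m
  0ᵖ = []
  1ᵖ = (1ℤ , Vec.replicate m 0) ∷ []

  var : Fin m → Poly m
  var e = (1ℤ , Vec.replicate m 0 [ e ]≔ 1) ∷ []

  _+ᵖ_ _*ᵖ_ : Poly m → Poly m → Poly m
  _+ᵖ_ = _++_
  _*ᵖ_ = cartesianProductWith
    λ { (c , M) (d , N) → c ℤ.* d , Vec.zipWith ℕ._+_ M N }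

  ∑ ∏ : List (Poly m) → Poly m
  ∑ = foldr _+ᵖ_ 0ᵖ
  ∏ = foldr _*ᵖ_ 1ᵖ

------------------------------------------------------------------------
-- Finite subsets

subsets : ∀ n → List (Subset n)
subsets zero    = [] ∷ []
subsets (suc n) = map (inside ∷_) (subsets n) ++ map (outside ∷_) (subsets n)

elements : ∀ {n} → Subset n → List (Fin n)
elements p = filter (_∈? p) (allFin _)

module _ {n} {P : Fin n → Set} (P? : Decidable P) where

  comprehension : Subset n
  comprehension = tabulate (does ∘ P?)

  ∈-comprehension⁺ : ∀ {i} → P i → i ∈ comprehension
  ∈-comprehension⁺ {i} Pi = lookup⇒[]= i comprehension
    (trans (lookup∘tabulate (does ∘ P?) i) (dec-true (P? i) Pi))

  ∈-comprehension⁻ : ∀ {i} → i ∈ comprehension → P i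
  ∈-comprehension⁻ {i} i∈ with P? i | trans (sym (lookup∘tabulate (does ∘ P?) i)) ([]=⇒lookup i∈)
  ... | yes Pi | _ = Pi

------------------------------------------------------------------------
-- Digraphs

-- Vertices and edges are drawn from Fin n and Fin m; the values of src and tgt
-- outside E are irrelevant.  The constructions below keep n and m and never
-- rename an edge, so an edge e : Fin m serves as its own label and a derived
-- digraph inherits the labels of the original one.
record Digraph (n m : ℕ) : Set where
  field
    V        : Subset n
    E        : Subset m
    src tgt  : Fin m → Fin n
    src∈V    : ∀ {e} → e ∈ E → src e ∈ V
    tgt∈V    : ∀ {e} → e ∈ E → tgt e ∈ V
    loopless : ∀ {e} → e ∈ E → src e ≢ tgt e

open Digraph public

private
  variable
    n m : ℕ

-- Path G x y es: the edges es, in this order, lead from x to y.  Vertices may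
-- repeat.  For the existence of paths and for domination this makes no
-- difference; for arborescences it makes uniqueness of paths exclude directed
-- cycles, including those through the root.
data Path (G : Digraph n m) : Fin n → Fin n → List (Fin m) → Set where
  []  : ∀ {x} → Path G x x []
  _∷_ : ∀ {e y es} → e ∈ E G → Path G (tgt G e) y es →
        Path G (src G e) y (e ∷ es)

Reachable : Digraph n m → Fin n → Fin n → Set
Reachable G x y = ∃[ es ] Path G x y es

record RootedAt (G : Digraph n m) (v : Fin n) : Set where
  field
    v∈V        : v ∈ V G
    noIncoming : ∀ {e} → e ∈ E G → tgt G e ≢ v
    reachable  : ∀ {w} → w ∈ V G → w ≢ v → Reachable G v w

module _ (G : Digraph n m) (D : Subset n) where

  inducedV? : Decidable (λ x → x ∈ V G × x ∈ D)
  inducedV? x = x ∈? V G ×-dec x ∈? D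

  inducedE? : Decidable (λ e → e ∈ E G × src G e ∈ D × tgt G e ∈ D)
  inducedE? e = e ∈? E G ×-dec src G e ∈? D ×-dec tgt G e ∈? D

  induced : Digraph n m
  induced = record
    { V        = comprehension inducedV?
    ; E        = comprehension inducedE?
    ; src      = src G
    ; tgt      = tgt G
    ; src∈V    = λ e∈ → let (e∈E , s∈D , _) = ∈-comprehension⁻ inducedE? e∈ in
                   ∈-comprehension⁺ inducedV? (src∈V G e∈E , s∈D)
    ; tgt∈V    = λ e∈ → let (e∈E , _ , t∈D) = ∈-comprehension⁻ inducedE? e∈ in
                   ∈-comprehension⁺ inducedV? (tgt∈V G e∈E , t∈D)
    ; loopless = λ e∈ → loopless G (proj₁ (∈-comprehension⁻ inducedE? e∈))
    }

module _ (u : Fin n) (F : Digraph n m) where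

  rootE? : Decidable (λ e → e ∈ E F × tgt F e ≢ u)
  rootE? e = e ∈? E F ×-dec ¬? (tgt F e ≟ u)

  root : Digraph n m
  root = record
    { V        = V F
    ; E        = comprehension rootE?
    ; src      = src F
    ; tgt      = tgt F
    ; src∈V    = λ e∈ → src∈V F (proj₁ (∈-comprehension⁻ rootE? e∈))
    ; tgt∈V    = λ e∈ → tgt∈V F (proj₁ (∈-comprehension⁻ rootE? e∈))
    ; loopless = λ e∈ → loopless F (proj₁ (∈-comprehension⁻ rootE? e∈))
    }

module _ (G : Digraph n m) (S : Subset n) (u : Fin n) (u∈S : u ∈ S) where

  Kept : Fin m → Set
  Kept e = e ∈ E G
         × ¬ (src G e ∉ S × tgt G e ∈ S × tgt G e ≢ u)
         × ¬ (src G e ∈ S × tgt G e ∈ S)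

  kept? : Decidable Kept
  kept? e = e ∈? E G
    ×-dec ¬? (¬? (src G e ∈? S) ×-dec tgt G e ∈? S ×-dec ¬? (tgt G e ≟ u))
    ×-dec ¬? (src G e ∈? S ×-dec tgt G e ∈? S)

  merge : Fin n → Fin n
  merge x = if does (x ∈? S) then u else x

  merge∈ : ∀ {x} → x ∈ V G → merge x ∈ (V G ─ S) ∪ ⁅ u ⁆
  merge∈ {x} x∈V with x ∈? S
  ... | yes _  = x∈p∪q⁺ (inj₂ (x∈⁅x⁆ u))
  ... | no x∉S = x∈p∪q⁺ (inj₁ (x∈p∧x∉q⇒x∈p─q x∈V x∉S))

  merge-loopless : ∀ {e} → Kept e → merge (src G e) ≢ merge (tgt G e)
  merge-loopless {e} (e∈E , _ , ¬both) with src G e ∈? S | tgt G e ∈? S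
  ... | yes s∈S | yes t∈S = λ _ → ¬both (s∈S , t∈S)
  ... | yes _   | no  t∉S = λ eq → t∉S (subst (_∈ S) eq u∈S)
  ... | no  s∉S | yes _   = λ eq → s∉S (subst (_∈ S) (sym eq) u∈S)
  ... | no  _   | no  _   = loopless G e∈E

  contract : Digraph n m
  contract = record
    { V        = (V G ─ S) ∪ ⁅ u ⁆
    ; E        = comprehension kept?
    ; src      = merge ∘ src G
    ; tgt      = merge ∘ tgt G
    ; src∈V    = λ e∈ → merge∈ (src∈V G (proj₁ (∈-comprehension⁻ kept? e∈)))
    ; tgt∈V    = λ e∈ → merge∈ (tgt∈V G (proj₁ (∈-comprehension⁻ kept? e∈)))
    ; loopless = λ e∈ → merge-loopless (∈-comprehension⁻ kept? e∈)
    }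

------------------------------------------------------------------------
-- Reachability is decidable

_++ᵖ_ : ∀ {G : Digraph n m} {x y z es fs} →
        Path G x y es → Path G y z fs → Path G x z (es ++ fs)
[]      ++ᵖ q = q
(i ∷ p) ++ᵖ q = i ∷ (p ++ᵖ q)

snocᵖ : ∀ {G : Digraph n m} {x es e} → Path G x (src G e) es → e ∈ E G →
        Path G x (tgt G e) (es ∷ʳ e)
snocᵖ p i = p ++ᵖ (i ∷ [])

unsnocᵖ : ∀ {G : Digraph n m} {x y e} es → Path G x y (es ∷ʳ e) →
          Path G x (src G e) es × e ∈ E G × tgt G e ≡ y
unsnocᵖ []       (i ∷ []) = [] , i , refl
unsnocᵖ (_ ∷ es) (i ∷ p)  = let (q , j , eq) = unsnocᵖ es p in i ∷ q , j , eq

module _ (G : Digraph n m) where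

  private
    Step : Fin n → Fin n → Set
    Step x y = x ≡ y ⊎ ∃[ e ] (e ∈ E G × src G e ≡ x × tgt G e ≡ y)

    -- x leads to y through intermediate vertices from the given list
    -- (the Floyd–Warshall recursion)
    Via : List (Fin n) → Fin n → Fin n → Set
    Via []       x y = Step x y
    Via (k ∷ ks) x y = Via ks x y ⊎ (Via ks x k × Via ks k y)

    via? : ∀ ks x y → Dec (Via ks x y)
    via? []       x y = (x ≟ y) ⊎-dec
      any? (λ e → e ∈? E G ×-dec (src G e ≟ x) ×-dec (tgt G e ≟ y))
    via? (k ∷ ks) x y = via? ks x y ⊎-dec (via? ks x k ×-dec via? ks k y)

    step⇒via : ∀ ks {x y} → Step x y → Via ks x y
    step⇒via []       s = s
    step⇒via (_ ∷ ks) s = inj₁ (step⇒via ks s)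

    via-to : ∀ {ks x k} → Via (k ∷ ks) x k → Via ks x k
    via-to (inj₁ p)       = p
    via-to (inj₂ (p , _)) = p

    via-from : ∀ {ks k y} → Via (k ∷ ks) k y → Via ks k y
    via-from (inj₁ p)       = p
    via-from (inj₂ (_ , p)) = p

    via-trans : ∀ {ks x y z} → z ∈ˡ ks → Via ks x z → Via ks z y → Via ks x y
    via-trans (here refl) p              q              = inj₂ (via-to p , via-from q)
    via-trans (there z∈)  (inj₁ p)       (inj₁ q)       = inj₁ (via-trans z∈ p q)
    via-trans (there z∈)  (inj₁ p)       (inj₂ (q , r)) = inj₂ (via-trans z∈ p q , r)
    via-trans (there z∈)  (inj₂ (p , q)) (inj₁ r)       = inj₂ (p , via-trans z∈ q r)
    via-trans (there z∈)  (inj₂ (p , _)) (inj₂ (_ , q)) = inj₂ (p , q)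

    via⇒reachable : ∀ ks {x y} → Via ks x y → Reachable G x y
    via⇒reachable []       (inj₁ refl)                  = [] , []
    via⇒reachable []       (inj₂ (e , e∈ , refl , refl)) = e ∷ [] , e∈ ∷ []
    via⇒reachable (_ ∷ ks) (inj₁ p)       = via⇒reachable ks p
    via⇒reachable (_ ∷ ks) (inj₂ (p , q)) =
      let (es , p′) = via⇒reachable ks p ; (fs , q′) = via⇒reachable ks q in
      es ++ fs , p′ ++ᵖ q′

    path⇒via : ∀ {x y es} → Path G x y es → Via (allFin n) x y
    path⇒via []               = step⇒via (allFin n) (inj₁ refl)
    path⇒via (_∷_ {e} e∈ p) =
      via-trans (∈-allFin (tgt G e))
        (step⇒via (allFin n) (inj₂ (e , e∈ , refl , refl))) (path⇒via p)

  reachable? : ∀ x y → Dec (Reachable G x y)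
  reachable? x y =
    map′ (via⇒reachable (allFin n)) (λ (_ , p) → path⇒via p) (via? (allFin n) x y)

------------------------------------------------------------------------
-- Domination

Dominates : Digraph n m → (v u w : Fin n) → Set
Dominates G v u w = ∀ {es} → Path G v w es → u ∈ˡ v ∷ map (tgt G) es

module _ (G : Digraph n m) (v u : Fin n) where

  private
    open DecMembership (_≟_ {n}) using () renaming (_∈?_ to _∈ˡ?_)

    G-u : Digraph n m
    G-u = induced G (V G - u)

    restrict : ∀ {x w es} → Path G x w es → ¬ (u ∈ˡ x ∷ map (tgt G) es) →
               Path G-u x w es
    restrict []       _  = []
    restrict (_∷_ {e} e∈ p) u∉ =
      ∈-comprehension⁺ (inducedE? G (V G - u))
        ( e∈
        , x∈p∧x≢y⇒x∈p-y (src∈V G e∈) (λ eq → u∉ (here (sym eq)))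
        , x∈p∧x≢y⇒x∈p-y (tgt∈V G e∈) (λ eq → u∉ (there (here (sym eq)))) )
      ∷ restrict p (u∉ ∘ there)

    u∉V-u : ∀ {k} (p : Subset k) x → x ∉ p - x
    u∉V-u (inside  ∷ _) Fin.zero ()
    u∉V-u (outside ∷ _) Fin.zero ()
    u∉V-u (_ ∷ p) (Fin.suc x) (Vec.there x∈) = u∉V-u p x x∈

    extend : ∀ {x w es} → Path G-u x w es → Path G x w es
    extend []       = []
    extend (e∈ ∷ p) = proj₁ (∈-comprehension⁻ (inducedE? G (V G - u)) e∈) ∷ extend p

    avoids : ∀ {x w es} → u ≢ x → Path G-u x w es → ¬ (u ∈ˡ x ∷ map (tgt G) es)
    avoids u≢x _        (here u≡x) = u≢x u≡x
    avoids u≢x (e∈ ∷ p) (there u∈) =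
      avoids (λ eq → u∉V-u (V G) u
               (subst (_∈ V G - u) (sym eq)
                 (proj₂ (proj₂ (∈-comprehension⁻ (inducedE? G (V G - u)) e∈)))))
             p u∈

  dominates? : Decidable (Dominates G v u)
  dominates? w with u ≟ v
  ... | yes u≡v = yes (λ _ → here u≡v)
  ... | no  u≢v with reachable? G-u v w
  ...   | yes (_ , p) = no (λ dom → avoids u≢v p (dom (extend p)))
  ...   | no  ¬p      = yes λ {es} p → through es p
    where
    through : ∀ es → Path G v w es → u ∈ˡ v ∷ map (tgt G) es
    through es p with u ∈ˡ? (v ∷ map (tgt G) es)
    ... | yes u∈ = u∈
    ... | no  u∉ = contradiction (es , restrict p u∉) ¬p

  dom? : Decidable (λ w → w ∈ V G × Dominates G v u w)
  dom? w = w ∈? V G ×-dec dominates? w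

  dom : Subset n
  dom = comprehension dom?

  ∈-dom⁺ : ∀ {w} → w ∈ V G → Dominates G v u w → w ∈ dom
  ∈-dom⁺ w∈V d = ∈-comprehension⁺ dom? (w∈V , d)

  ∈-dom⁻ : ∀ {w} → w ∈ dom → w ∈ V G × Dominates G v u w
  ∈-dom⁻ = ∈-comprehension⁻ dom?

  u∈dom : u ∈ V G → u ∈ dom
  u∈dom u∈V = ∈-dom⁺ u∈V end∈
    where
    end∈ : ∀ {x es} → Path G x u es → u ∈ˡ x ∷ map (tgt G) es
    end∈ []      = here refl
    end∈ (_ ∷ p) = there (end∈ p)

------------------------------------------------------------------------
-- Arborescences and the Kirchhoff polynomial

spanning : (G : Digraph n m) (A : Subset m) → A ⊆ E G → Digraph n m
spanning G A A⊆E = record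
  { V        = V G
  ; E        = A
  ; src      = src G
  ; tgt      = tgt G
  ; src∈V    = src∈V G ∘ A⊆E
  ; tgt∈V    = tgt∈V G ∘ A⊆E
  ; loopless = loopless G ∘ A⊆E
  }

UniquelyReachesAll : Digraph n m → Fin n → Set
UniquelyReachesAll H r = ∀ w → w ∈ V H → ∃! _≡_ (Path H r w)

IsArborescence : Digraph n m → Subset m → Set
IsArborescence G A =
  Σ[ A⊆E ∈ A ⊆ E G ] ∃[ r ] (r ∈ V G × UniquelyReachesAll (spanning G A A⊆E) r)

module _ (H : Digraph n m) where

  private
    TreeAt : Fin n → Set
    TreeAt r = (∀ w → w ∈ V H → Reachable H r w)
             × (∀ e → e ∈ E H → tgt H e ≢ r)
             × (∀ e → e ∈ E H → ∀ f → f ∈ E H → tgt H e ≡ tgt H f → e ≡ f)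

    treeAt? : Decidable TreeAt
    treeAt? r =
      all? (λ w → w ∈? V H →-dec reachable? H r w)
      ×-dec all? (λ e → e ∈? E H →-dec ¬? (tgt H e ≟ r))
      ×-dec all? (λ e → e ∈? E H →-dec all? (λ f → f ∈? E H →-dec
              ((tgt H e ≟ tgt H f) →-dec (e ≟ f))))

    unique⇒≡ : ∀ {r w es fs} → ∃! _≡_ (Path H r w) →
               Path H r w es → Path H r w fs → es ≡ fs
    unique⇒≡ (_ , _ , u) p q = trans (sym (u p)) (u q)

    snoc≢[] : ∀ (es : List (Fin m)) {e} → es ∷ʳ e ≢ []
    snoc≢[] []      ()
    snoc≢[] (_ ∷ _) ()

    unique⇒tree : ∀ {r} → r ∈ V H → UniquelyReachesAll H r → TreeAt r
    unique⇒tree {r} r∈V uniq =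
        (λ w w∈ → let (es , p , _) = uniq w w∈ in es , p)
      , (λ e e∈ eq →
          let (es , p , _) = uniq (src H e) (src∈V H e∈) in
          snoc≢[] es (unique⇒≡ (uniq r r∈V)
            (subst (λ x → Path H r x (es ∷ʳ e)) eq (snocᵖ p e∈)) []))
      , (λ e e∈ f f∈ eq →
          let (es , p , _) = uniq (src H e) (src∈V H e∈)
              (fs , q , _) = uniq (src H f) (src∈V H f∈)
          in ∷ʳ-injectiveʳ es fs (unique⇒≡ (uniq (tgt H f) (tgt∈V H f∈))
               (subst (λ x → Path H r x (es ∷ʳ e)) eq (snocᵖ p e∈)) (snocᵖ q f∈)))

    tree⇒unique : ∀ {r} → TreeAt r → UniquelyReachesAll H r
    tree⇒unique {r} (reach , noIn , inj) w w∈ =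
      let (es , p) = reach w w∈ in
      es , p , λ {fs} q → same (reverseView es) (reverseView fs) p q
      where
      same : ∀ {y es fs} → Reverse es → Reverse fs →
             Path H r y es → Path H r y fs → es ≡ fs
      same []              []              _  _ = refl
      same []              (fs ∶ _ ∶ʳ f)   [] q =
        let (_ , f∈ , eq) = unsnocᵖ fs q in contradiction eq (noIn f f∈)
      same (es ∶ _ ∶ʳ e)   []              p [] =
        let (_ , e∈ , eq) = unsnocᵖ es p in contradiction eq (noIn e e∈)
      same (es ∶ res ∶ʳ e) (fs ∶ rfs ∶ʳ f) p q
        with unsnocᵖ es p | unsnocᵖ fs q
      ... | p′ , e∈ , eq | q′ , f∈ , eq′
        with refl ← inj e e∈ f f∈ (trans eq (sym eq′)) =
        cong (_∷ʳ e) (same res rfs p′ q′)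

  uniquelyReachesAll? : Dec (∃[ r ] (r ∈ V H × UniquelyReachesAll H r))
  uniquelyReachesAll? =
    map′ (λ (r , r∈ , t) → r , r∈ , tree⇒unique t)
         (λ (r , r∈ , u) → r , r∈ , unique⇒tree r∈ u)
         (any? (λ r → r ∈? V H ×-dec treeAt? r))

isArborescence? : (G : Digraph n m) → Decidable (IsArborescence G)
isArborescence? G A with A ⊆? E G
... | no  A⊈E = no (A⊈E ∘ proj₁)
... | yes A⊆E = map′ (λ t → (λ {x} → A⊆E {x}) , t) (λ (_ , t) → transport t)
                     (uniquelyReachesAll? (spanning G A A⊆E))
  where
  -- Paths do not depend on the proof of A ⊆ E G.
  path : ∀ {i j : A ⊆ E G} {x y es} →
         Path (spanning G A i) x y es → Path (spanning G A j) x y es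
  path []       = []
  path (e∈ ∷ p) = e∈ ∷ path p

  transport : ∀ {i j : A ⊆ E G} →
    ∃[ r ] (r ∈ V G × UniquelyReachesAll (spanning G A i) r) →
    ∃[ r ] (r ∈ V G × UniquelyReachesAll (spanning G A j) r)
  transport {i} {j} (r , r∈ , u) = r , r∈ , λ w w∈ →
    let (es , p , un) = u w w∈ in es , path {i} {j} p , λ q → un (path {j} {i} q)

arb : Digraph n m → List (Subset m)
arb {m = m} G = filter (isArborescence? G) (subsets m)

κ : Digraph n m → Poly m
κ G = ∑ (map (λ A → ∏ (map var (elements A))) (arb G))

{-# OPTIONS --safe #-}
module Submission where

-- An arborescence of G has root v.  It can only enter D through u, because an
-- edge of G into D ─ u starts in D, and no edge of D enters u in it, because
-- u already lies on the path to the source of such an edge.  So it is the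
-- disjoint union of an arborescence of G[D] with root u and an arborescence of
-- G(D → u), and every such union is an arborescence of G.  Since κ lists one
-- squarefree monomial per arborescence, this bijection gives the factorization.

open import Data.Bool.Base using (if_then_else_)
open import Data.Fin.Base using (Fin)
open import Data.Fin.Properties using (_≟_)
open import Data.Fin.Subset
  using (Subset; inside; outside; _∈_; _∉_; _⊆_; _∩_; _∪_; _─_)
open import Data.Fin.Subset.Properties
  using (_∈?_; x∈p∩q⁺; x∈p∩q⁻; x∈p∪q⁺; x∈p∪q⁻; p∩q⊆p; p∩q⊆q; p─q⊆p; ⊆-antisym;
         x∈p∧x∉q⇒x∈p─q; x∈⁅x⁆; x∈⁅y⁆⇒x≡y)
open import Data.Integer.Base as ℤ using (ℤ; 0ℤ; 1ℤ)
import Data.Integer.Properties as ℤₚ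
open import Data.List.Base
  using (List; []; _∷_; _++_; _∷ʳ_; _∷ʳ′_; initLast; map; filter; allFin;
         cartesianProduct; cartesianProductWith)
open import Data.List.Membership.Propositional using () renaming (_∈_ to _∈ˡ_)
open import Data.List.Membership.Propositional.Properties
  using (∈-map⁺; ∈-map⁻; ∈-++⁺ˡ; ∈-++⁺ʳ; ∈-++⁻; ∈-filter⁺; ∈-filter⁻;
         ∈-cartesianProduct⁺; ∈-cartesianProduct⁻)
open import Data.List.Membership.Propositional.Properties.WithK using (unique∧set⇒bag)
open import Data.List.Properties
  using (map-++; map-∘; map-id-local; map-cong-local; ++-assoc; ++-identityʳ;
         ∷-injectiveʳ; ∷ʳ-injectiveʳ)
open import Data.List.Relation.Binary.BagAndSetEquality using (∼bag⇒↭)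
open import Data.List.Relation.Binary.Disjoint.Propositional using (Disjoint)
open import Data.List.Relation.Binary.Permutation.Propositional as Perm using (_↭_)
open import Data.List.Relation.Binary.Permutation.Propositional.Properties
  using () renaming (map⁺ to ↭-map⁺)
open import Data.List.Relation.Unary.All using ([]; tabulate)
open import Data.List.Relation.Unary.AllPairs using ([]; _∷_)
open import Data.List.Relation.Unary.Any using (here; there)
open import Data.List.Relation.Unary.Unique.Propositional using (Unique)
import Data.List.Relation.Unary.Unique.Propositional.Properties as Uniqueₚ
open import Data.Nat.Base as ℕ using (ℕ; zero; suc)
import Data.Nat.Properties as ℕₚ
open import Data.Product.Base using (∃₂; _×_; _,_; proj₁; proj₂; uncurry)
open import Data.Sum.Base using (_⊎_; inj₁; inj₂; [_,_]′)
open import Data.Vec.Base as Vec using ([]; _∷_; zipWith; replicate; _[_]≔_)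
open import Data.Vec.Properties
  using (zipWith-assoc; zipWith-comm; zipWith-identityˡ; ≡-dec)
  renaming (∷-injectiveʳ to ∷-injectiveʳᵛ)
open import Function.Base using (_∘_)
open import Function.Bundles using (mk⇔)
open import Relation.Binary.PropositionalEquality
  using (_≡_; _≢_; refl; sym; trans; cong; cong₂; subst; module ≡-Reasoning)
open import Relation.Nullary using (yes; no; contradiction)
open import Relation.Nullary.Decidable using (does)

open import Defs

private
  variable
    n n′ n″ m : ℕ

x∈p─q⇒x∉q : ∀ (p q : Subset n) {x} → x ∈ p ─ q → x ∉ q
x∈p─q⇒x∉q (_ ∷ p) (_ ∷ q) (Vec.there x∈) (Vec.there x∈q) = x∈p─q⇒x∉q p q x∈ x∈q

-- The Kirchhoff polynomial as a list of monomials

infixl 6 _⊕_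

_⊕_ : Monomial m → Monomial m → Monomial m
_⊕_ = zipWith ℕ._+_

⊕-assoc : (L M N : Monomial m) → (L ⊕ M) ⊕ N ≡ L ⊕ (M ⊕ N)
⊕-assoc = zipWith-assoc ℕₚ.+-assoc

⊕-comm : (M N : Monomial m) → M ⊕ N ≡ N ⊕ M
⊕-comm = zipWith-comm ℕₚ.+-comm

-- The recursion copies that of `∏`, so that multiplying out a product of variables is mere
-- computation.
monomial : List (Fin m) → Monomial m
monomial []       = replicate _ 0
monomial (e ∷ es) = (replicate _ 0 [ e ]≔ 1) ⊕ monomial es

term : List (Fin m) → ℤ × Monomial m
term es = 1ℤ , monomial es

∏-var : (es : List (Fin m)) → ∏ (map var es) ≡ term es ∷ []
∏-var []       = refl
∏-var (e ∷ es) = cong (var e *ᵖ_) (∏-var es)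

∑∏-var : (As : List (Subset m)) →
         ∑ (map (λ A → ∏ (map var (elements A))) As) ≡ map (term ∘ elements) As
∑∏-var []       = refl
∑∏-var (A ∷ As) = cong₂ _++_ (∏-var (elements A)) (∑∏-var As)

κ-terms : (G : Digraph n m) → κ G ≡ map (term ∘ elements) (arb G)
κ-terms G = ∑∏-var (arb G)

-- By disjointness each edge of the union contributes to exactly one of the two factors. An
-- arbitrary list `es` in place of all edges makes the induction possible.
monomial-∪ : (B C : Subset m) → (∀ {e} → e ∈ B → e ∉ C) → (es : List (Fin m)) →
             monomial (filter (_∈? (B ∪ C)) es) ≡
             monomial (filter (_∈? B) es) ⊕ monomial (filter (_∈? C) es)
monomial-∪ B C disj [] = sym (zipWith-identityˡ (λ _ → refl) _)
monomial-∪ B C disj (e ∷ es) with e ∈? B | e ∈? C | e ∈? (B ∪ C)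
... | yes e∈B | yes e∈C | _       = contradiction e∈C (disj e∈B)
... | yes e∈B | no  e∉C | no  e∉∪ = contradiction (x∈p∪q⁺ (inj₁ e∈B)) e∉∪
... | no  e∉B | yes e∈C | no  e∉∪ = contradiction (x∈p∪q⁺ (inj₂ e∈C)) e∉∪
... | no  e∉B | no  e∉C | yes e∈∪ = contradiction (x∈p∪q⁻ B C e∈∪) [ e∉B , e∉C ]′
... | no  e∉B | no  e∉C | no  e∉∪ = monomial-∪ B C disj es
... | yes e∈B | no  e∉C | yes e∈∪ =
  trans (cong (_ ⊕_) (monomial-∪ B C disj es)) (sym (⊕-assoc _ _ _))
... | no  e∉B | yes e∈C | yes e∈∪ = begin
  X ⊕ monomial (filter (_∈? (B ∪ C)) es) ≡⟨ cong (X ⊕_) (monomial-∪ B C disj es) ⟩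
  X ⊕ (M ⊕ N)                            ≡⟨ sym (⊕-assoc X M N) ⟩
  X ⊕ M ⊕ N                              ≡⟨ cong (_⊕ N) (⊕-comm X M) ⟩
  M ⊕ X ⊕ N                              ≡⟨ ⊕-assoc M X N ⟩
  M ⊕ (X ⊕ N)                            ∎
  where
  open ≡-Reasoning
  X = replicate _ 0 [ e ]≔ 1
  M = monomial (filter (_∈? B) es)
  N = monomial (filter (_∈? C) es)

-- A coefficient is a sum over all terms of the list, and addition in ℤ is commutative and
-- associative.
↭⇒≈ : {p q : Poly m} → p ↭ q → p ≈ q
↭⇒≈ Perm.refl                   M = refl
↭⇒≈ (Perm.trans p↭q q↭r)        M = trans (↭⇒≈ p↭q M) (↭⇒≈ q↭r M)
↭⇒≈ (Perm.prep (c , K) p↭q)     M =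
  cong (ℤ._+_ (if does (≡-dec ℕₚ._≟_ K M) then c else 0ℤ)) (↭⇒≈ p↭q M)
↭⇒≈ (Perm.swap {p} {q} (c , K) (d , L) p↭q) M = begin
  x ℤ.+ (y ℤ.+ coeff p M) ≡⟨ cong (λ z → x ℤ.+ (y ℤ.+ z)) (↭⇒≈ p↭q M) ⟩
  x ℤ.+ (y ℤ.+ coeff q M) ≡⟨ sym (ℤₚ.+-assoc x y _) ⟩
  x ℤ.+ y ℤ.+ coeff q M   ≡⟨ cong (ℤ._+ coeff q M) (ℤₚ.+-comm x y) ⟩
  y ℤ.+ x ℤ.+ coeff q M   ≡⟨ ℤₚ.+-assoc y x _ ⟩
  y ℤ.+ (x ℤ.+ coeff q M) ∎
  where
  open ≡-Reasoning
  x = if does (≡-dec ℕₚ._≟_ K M) then c else 0ℤ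
  y = if does (≡-dec ℕₚ._≟_ L M) then d else 0ℤ

-- Turns a product of two sums over arborescences into one sum over pairs of arborescences.
cartesianProductWith-map :
  ∀ {A B C A′ B′ : Set} (f : A′ → B′ → C) (g : A → A′) (h : B → B′) xs ys →
  cartesianProductWith f (map g xs) (map h ys) ≡
  map (λ (x , y) → f (g x) (h y)) (cartesianProduct xs ys)
cartesianProductWith-map f g h []       ys = refl
cartesianProductWith-map f g h (x ∷ xs) ys = begin
  map (f (g x)) (map h ys) ++ cartesianProductWith f (map g xs) (map h ys)
    ≡⟨ cong₂ _++_ (trans (sym (map-∘ ys)) (map-∘ ys)) (cartesianProductWith-map f g h xs ys) ⟩
  map k (map (x ,_) ys) ++ map k (cartesianProduct xs ys)
    ≡⟨ sym (map-++ k (map (x ,_) ys) _) ⟩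
  map k (cartesianProduct (x ∷ xs) ys) ∎
  where
  open ≡-Reasoning
  k = λ (x , y) → f (g x) (h y)

-- Enumerating subsets and arborescences without repetition

∈-subsets : (A : Subset n) → A ∈ˡ subsets n
∈-subsets []            = here refl
∈-subsets (inside  ∷ A) = ∈-++⁺ˡ (∈-map⁺ (inside ∷_) (∈-subsets A))
∈-subsets (outside ∷ A) = ∈-++⁺ʳ _ (∈-map⁺ (outside ∷_) (∈-subsets A))

subsets-unique : ∀ n → Unique (subsets n)
subsets-unique zero    = [] ∷ []
subsets-unique (suc n) = Uniqueₚ.++⁺
  (Uniqueₚ.map⁺ ∷-injectiveʳᵛ (subsets-unique n))
  (Uniqueₚ.map⁺ ∷-injectiveʳᵛ (subsets-unique n))
  disjoint
  where
  disjoint : Disjoint (map (inside ∷_) (subsets n)) (map (outside ∷_) (subsets n))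
  disjoint (i , o) with _ , _ , refl ← ∈-map⁻ _ i with _ , _ , () ← ∈-map⁻ _ o

∈-arb⁺ : {G : Digraph n m} {A : Subset m} → IsArborescence G A → A ∈ˡ arb G
∈-arb⁺ {G = G} = ∈-filter⁺ (isArborescence? G) (∈-subsets _)

∈-arb⁻ : {G : Digraph n m} {A : Subset m} → A ∈ˡ arb G → IsArborescence G A
∈-arb⁻ {m = m} {G = G} A∈ = proj₂ (∈-filter⁻ (isArborescence? G) {xs = subsets m} A∈)

arb-unique : (G : Digraph n m) → Unique (arb G)
arb-unique G = Uniqueₚ.filter⁺ (isArborescence? G) (subsets-unique _)

-- From a bijection between arborescences and pairs to a factorization of `κ`

module _ (G : Digraph n m) (H : Digraph n′ m) (K : Digraph n″ m)
  (disjoint : ∀ {e} → e ∈ E H → e ∉ E K)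
  (split : ∀ {A} → IsArborescence G A →
           A ⊆ E H ∪ E K × IsArborescence H (A ∩ E H) × IsArborescence K (A ∩ E K))
  (join : ∀ {B C} → IsArborescence H B → IsArborescence K C → IsArborescence G (B ∪ C))
  where

  private
    pairs : List (Subset m × Subset m)
    pairs = cartesianProduct (arb H) (arb K)

    ∈-pairs⁻ : ∀ {B C} → (B , C) ∈ˡ pairs → IsArborescence H B × IsArborescence K C
    ∈-pairs⁻ BC∈ = let (B∈ , C∈) = ∈-cartesianProduct⁻ (arb H) (arb K) BC∈ in
      ∈-arb⁻ B∈ , ∈-arb⁻ C∈

    restrict : Subset m → Subset m × Subset m
    restrict A = A ∩ E H , A ∩ E K

    restrict-∪ : ∀ {B C} → B ⊆ E H → C ⊆ E K → restrict (B ∪ C) ≡ (B , C)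
    restrict-∪ {B} {C} B⊆ C⊆ = cong₂ _,_
      (⊆-antisym
        (λ e∈ → let (e∈∪ , e∈H) = x∈p∩q⁻ (B ∪ C) (E H) e∈ in
          [ (λ e∈B → e∈B) , (λ e∈C → contradiction (C⊆ e∈C) (disjoint e∈H)) ]′ (x∈p∪q⁻ B C e∈∪))
        (λ e∈B → x∈p∩q⁺ (x∈p∪q⁺ (inj₁ e∈B) , B⊆ e∈B)))
      (⊆-antisym
        (λ e∈ → let (e∈∪ , e∈K) = x∈p∩q⁻ (B ∪ C) (E K) e∈ in
          [ (λ e∈B → contradiction e∈K (disjoint (B⊆ e∈B))) , (λ e∈C → e∈C) ]′ (x∈p∪q⁻ B C e∈∪))
        (λ e∈C → x∈p∩q⁺ (x∈p∪q⁺ (inj₂ e∈C) , C⊆ e∈C)))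

    ∪-restrict : ∀ {A} → A ⊆ E H ∪ E K → (A ∩ E H) ∪ (A ∩ E K) ≡ A
    ∪-restrict {A} A⊆ = ⊆-antisym
      (λ e∈ → [ p∩q⊆p A (E H) , p∩q⊆p A (E K) ]′ (x∈p∪q⁻ (A ∩ E H) (A ∩ E K) e∈))
      (λ e∈A → x∈p∪q⁺ ([ (λ e∈H → inj₁ (x∈p∩q⁺ (e∈A , e∈H)))
                       , (λ e∈K → inj₂ (x∈p∩q⁺ (e∈A , e∈K))) ]′ (x∈p∪q⁻ (E H) (E K) (A⊆ e∈A))))

    -- The left inverse `restrict` of the union carries the list of unions back to `pairs`, which
    -- has no repetitions; so no union occurs twice.
    unions-unique : Unique (map (uncurry _∪_) pairs)
    unions-unique = Uniqueₚ.map⁻ {f = restrict} (subst Unique (sym restrict-unions)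
      (Uniqueₚ.cartesianProduct⁺ (arb-unique H) (arb-unique K)))
      where
      restrict-unions : map restrict (map (uncurry _∪_) pairs) ≡ pairs
      restrict-unions = trans (sym (map-∘ pairs)) (map-id-local (tabulate λ BC∈ →
        let (B⊆ , _) , (C⊆ , _) = ∈-pairs⁻ BC∈ in restrict-∪ B⊆ C⊆))

    -- Two lists without repetitions that have the same members are permutations of each other.
    arb↭unions : arb G ↭ map (uncurry _∪_) pairs
    arb↭unions = ∼bag⇒↭ (unique∧set⇒bag (arb-unique G) unions-unique (mk⇔ to from))
      where
      to : ∀ {A} → A ∈ˡ arb G → A ∈ˡ map (uncurry _∪_) pairs
      to A∈ = let (A⊆ , B , C) = split (∈-arb⁻ A∈) in
        subst (_∈ˡ map (uncurry _∪_) pairs) (∪-restrict A⊆)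
          (∈-map⁺ (uncurry _∪_) (∈-cartesianProduct⁺ (∈-arb⁺ B) (∈-arb⁺ C)))
      from : ∀ {A} → A ∈ˡ map (uncurry _∪_) pairs → A ∈ˡ arb G
      from A∈ with (B , C) , BC∈ , refl ← ∈-map⁻ (uncurry _∪_) A∈ =
        ∈-arb⁺ (uncurry join (∈-pairs⁻ BC∈))

    terms-unions : map (term ∘ elements) (map (uncurry _∪_) pairs) ≡ κ H *ᵖ κ K
    terms-unions = begin
      map (term ∘ elements) (map (uncurry _∪_) pairs)
        ≡⟨ sym (map-∘ pairs) ⟩
      map (λ (B , C) → term (elements (B ∪ C))) pairs
        ≡⟨ map-cong-local (tabulate λ BC∈ →
             let (B⊆ , _) , (C⊆ , _) = ∈-pairs⁻ BC∈ in
             cong (1ℤ ,_) (monomial-∪ _ _ (λ e∈B e∈C → disjoint (B⊆ e∈B) (C⊆ e∈C)) (allFin _))) ⟩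
      map (λ (B , C) → 1ℤ , monomial (elements B) ⊕ monomial (elements C)) pairs
        ≡⟨ sym (cartesianProductWith-map _ _ _ (arb H) (arb K)) ⟩
      map (term ∘ elements) (arb H) *ᵖ map (term ∘ elements) (arb K)
        ≡⟨ sym (cong₂ _*ᵖ_ (κ-terms H) (κ-terms K)) ⟩
      κ H *ᵖ κ K ∎
      where open ≡-Reasoning

  κ-factor : κ G ≈ κ H *ᵖ κ K
  κ-factor M = begin
    coeff (κ G) M                                               ≡⟨ cong (λ p → coeff p M) (κ-terms G) ⟩
    coeff (map (term ∘ elements) (arb G)) M                     ≡⟨ ↭⇒≈ (↭-map⁺ (term ∘ elements) arb↭unions) M ⟩
    coeff (map (term ∘ elements) (map (uncurry _∪_) pairs)) M   ≡⟨ cong (λ p → coeff p M) terms-unions ⟩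
    coeff (κ H *ᵖ κ K) M                                        ∎
    where open ≡-Reasoning

-- Arborescences and paths

-- For a vertex `r` this is equivalent to `UniquelyReachesAll H r`. The last two conditions speak of
-- edges only, so they pass to subsets of edges and can be checked edge by edge in a union.
record Tree (H : Digraph n m) (r : Fin n) : Set where
  field
    reaches  : ∀ {w} → w ∈ V H → Reachable H r w
    noEntry  : ∀ {e} → e ∈ E H → tgt H e ≢ r
    oneEntry : ∀ {e f} → e ∈ E H → f ∈ E H → tgt H e ≡ tgt H f → e ≡ f

open Tree

module _ {H : Digraph n m} where

  -- Induction from the start of the path, with the edges already traversed accumulated in `es`.
  -- `Path` grows at its front, while arguments about entering edges need the last edge.
  path-elim : (P : Fin n → List (Fin m) → Set) →
              (∀ {e es} → e ∈ E H → P (src H e) es → P (tgt H e) (es ∷ʳ e)) →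
              ∀ {x y es fs} → Path H x y fs → P x es → P y (es ++ fs)
  path-elim P step {es = es} [] Px = subst (P _) (sym (++-identityʳ es)) Px
  path-elim P step {es = es} (_∷_ {e} {es = fs} e∈ p) Px =
    subst (P _) (++-assoc es (e ∷ []) fs) (path-elim P step p (step e∈ Px))

  path-invariant : (P : Fin n → Set) → (∀ {e} → e ∈ E H → P (src H e) → P (tgt H e)) →
                   ∀ {x y es} → Path H x y es → P x → P y
  path-invariant P step []       Px = Px
  path-invariant P step (e∈ ∷ p) Px = path-invariant P step p (step e∈ Px)

  path-[] : ∀ {x y} → Path H x y [] → x ≡ y
  path-[] [] = refl

  -- A nonempty path to `y` would end with an edge entering `y`.
  path-to-source : ∀ {x y es} → (∀ {e} → e ∈ E H → tgt H e ≢ y) → Path H x y es → x ≡ y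
  path-to-source noIn []       = refl
  path-to-source noIn (e∈ ∷ p) = contradiction (path-to-source noIn p) (noIn e∈)

  path-prefix : ∀ {x y z es} → Path H x y es → z ∈ˡ x ∷ map (tgt H) es →
                ∃₂ λ fs gs → Path H x z fs × es ≡ fs ++ gs
  path-prefix p        (here refl) = [] , _ , [] , refl
  path-prefix (e∈ ∷ p) (there z∈)  =
    let (fs , gs , q , eq) = path-prefix p z∈ in _ ∷ fs , gs , e∈ ∷ q , cong (_ ∷_) eq

  snocʳ : ∀ {x e} → Reachable H x (src H e) → e ∈ E H → Reachable H x (tgt H e)
  snocʳ (_ , p) e∈ = _ , snocᵖ p e∈

  transʳ : ∀ {x y z} → Reachable H x y → Reachable H y z → Reachable H x z
  transʳ (_ , p) (_ , q) = _ , p ++ᵖ q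

  module _ {r : Fin n} where

    unique-path : UniquelyReachesAll H r → ∀ {w es fs} → w ∈ V H →
                  Path H r w es → Path H r w fs → es ≡ fs
    unique-path uniq w∈ p q = let (_ , _ , u) = uniq _ w∈ in trans (sym (u p)) (u q)

    -- An edge entering `r` would close a path from `r` to itself besides the empty one. Two edges
    -- with a common target extend the paths to their sources to paths with the same ends, so the
    -- last edges agree.
    uniquelyReachesAll⇒tree : r ∈ V H → UniquelyReachesAll H r → Tree H r
    uniquelyReachesAll⇒tree r∈V uniq = record
      { reaches  = reach
      ; noEntry  = λ e∈ eq → let (es , p) = reach (src∈V H e∈) in
          snoc≢[] es (unique-path uniq r∈V (subst (λ x → Path H r x _) eq (snocᵖ p e∈)) [])
      ; oneEntry = λ e∈ f∈ eq →
          let (es , p) = reach (src∈V H e∈) ; (fs , q) = reach (src∈V H f∈) in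
          ∷ʳ-injectiveʳ es fs (unique-path uniq (tgt∈V H f∈)
            (subst (λ x → Path H r x _) eq (snocᵖ p e∈)) (snocᵖ q f∈))
      }
      where
      reach : ∀ {w} → w ∈ V H → Reachable H r w
      reach w∈ = let (es , p , _) = uniq _ w∈ in es , p

      snoc≢[] : ∀ (es : List (Fin m)) {e} → es ∷ʳ e ≢ []
      snoc≢[] []      ()
      snoc≢[] (_ ∷ _) ()

    -- Any competing path is compared from its end: at the root `noEntry` leaves only the empty
    -- path, and elsewhere `oneEntry` determines the last edge.
    tree⇒uniquelyReachesAll : Tree H r → UniquelyReachesAll H r
    tree⇒uniquelyReachesAll t w w∈ = let (es , p) = reaches t w∈ in
      es , p , λ {fs} q → path-elim OnlyPath extend p start q
      where
      OnlyPath : Fin n → List (Fin m) → Set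
      OnlyPath y es = ∀ {fs} → Path H r y fs → es ≡ fs

      start : OnlyPath r []
      start {fs} q with initLast fs
      ... | []       = refl
      ... | gs ∷ʳ′ f = let (_ , f∈ , eq) = unsnocᵖ gs q in contradiction eq (noEntry t f∈)

      extend : ∀ {e es} → e ∈ E H → OnlyPath (src H e) es → OnlyPath (tgt H e) (es ∷ʳ e)
      extend e∈ only {fs} q with initLast fs
      ... | []       = contradiction (sym (path-[] q)) (noEntry t e∈)
      ... | gs ∷ʳ′ f with q′ , f∈ , eq ← unsnocᵖ gs q
                     with refl ← oneEntry t e∈ f∈ (sym eq) = cong (_∷ʳ _) (only q′)

module _ (G : Digraph n m) {A : Subset m} where

  -- The root reaches `x` by a path, which must be empty as no edge enters `x`; hence the root is
  -- `x`.
  arborescence⇒tree : (arb : IsArborescence G A) → ∀ {x} → x ∈ V G →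
                      (∀ {e} → e ∈ E G → tgt G e ≢ x) → Tree (spanning G A (proj₁ arb)) x
  arborescence⇒tree (A⊆E , r , r∈V , uniq) x∈V noIn =
    subst (Tree _) (path-to-source (noIn ∘ A⊆E) (proj₂ (reaches t x∈V))) t
    where
    t : Tree (spanning G A A⊆E) r
    t = uniquelyReachesAll⇒tree r∈V uniq

  tree⇒arborescence : (A⊆E : A ⊆ E G) → ∀ {r} → r ∈ V G → Tree (spanning G A A⊆E) r →
                      IsArborescence G A
  tree⇒arborescence A⊆E r∈V t = A⊆E , _ , r∈V , tree⇒uniquelyReachesAll t

  spanning-path : ∀ {A⊆E : A ⊆ E G} {x y es} → Path (spanning G A A⊆E) x y es → Path G x y es
  spanning-path []                 = []
  spanning-path {A⊆E = A⊆E} (e∈ ∷ p) = A⊆E e∈ ∷ spanning-path p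

module _ (G : Digraph n m) (v : Fin n) (rooted : RootedAt G v) (u : Fin n) (u∈V : u ∈ V G) where

  open RootedAt rooted

  -- The digraphs `H` and `K` cut out by the dominated set `D`

  private
    D : Subset n
    D = dom G v u

    u∈D : u ∈ D
    u∈D = u∈dom G v u u∈V

    H K : Digraph n m
    H = root u (induced G D)
    K = contract G D u u∈D

    ⟨_⟩ : Fin n → Fin n
    ⟨_⟩ = merge G D u u∈D

    v∈D⇒u≡v : v ∈ D → u ≡ v
    v∈D⇒u≡v v∈D with proj₂ (∈-dom⁻ G v u v∈D) []
    ... | here u≡v = u≡v

    -- A path to the source of `e`, prolonged by `e`, passes through `u`. As `u` is not the final
    -- vertex, it already lies on the path to the source.
    src∈D : ∀ {e} → e ∈ E G → tgt G e ∈ D → tgt G e ≢ u → src G e ∈ D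
    src∈D {e} e∈ t∈D t≢u = ∈-dom⁺ G v u (src∈V G e∈) λ {es} p →
      [ (λ u∈ → u∈) , (λ { (here u≡t) → contradiction (sym u≡t) t≢u }) ]′
        (∈-++⁻ (v ∷ map (tgt G) es)
          (subst (λ xs → u ∈ˡ v ∷ xs) (map-++ (tgt G) es (e ∷ []))
            (proj₂ (∈-dom⁻ G v u t∈D) (snocᵖ p e∈))))

    H-edge⁺ : ∀ {e} → e ∈ E G → src G e ∈ D → tgt G e ∈ D → tgt G e ≢ u → e ∈ E H
    H-edge⁺ e∈ s∈D t∈D t≢u = ∈-comprehension⁺ (rootE? u (induced G D))
      (∈-comprehension⁺ (inducedE? G D) (e∈ , s∈D , t∈D) , t≢u)

    H-edge⁻ : ∀ {e} → e ∈ E H → e ∈ E G × src G e ∈ D × tgt G e ∈ D × tgt G e ≢ u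
    H-edge⁻ e∈ = let (e∈I , t≢u) = ∈-comprehension⁻ (rootE? u (induced G D)) e∈
                     (e∈E , s∈D , t∈D) = ∈-comprehension⁻ (inducedE? G D) e∈I in
      e∈E , s∈D , t∈D , t≢u

    H-vertex⁺ : ∀ {x} → x ∈ D → x ∈ V H
    H-vertex⁺ x∈D = ∈-comprehension⁺ (inducedV? G D) (proj₁ (∈-dom⁻ G v u x∈D) , x∈D)

    -- The contraction also removes edges that enter `D` from outside at a vertex other than `u`,
    -- but by `src∈D` there are none.
    K-edge⁺ : ∀ {e} → e ∈ E G → e ∈ E K ⊎ (src G e ∈ D × tgt G e ∈ D)
    K-edge⁺ {e} e∈ with src G e ∈? D | tgt G e ∈? D
    ... | yes s∈D | yes t∈D = inj₂ (s∈D , t∈D)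
    ... | yes s∈D | no  t∉D = inj₁ (∈-comprehension⁺ (kept? G D u u∈D)
      (e∈ , (λ (s∉D , _) → s∉D s∈D) , (λ (_ , t∈D) → t∉D t∈D)))
    ... | no  s∉D | _       = inj₁ (∈-comprehension⁺ (kept? G D u u∈D)
      (e∈ , (λ (_ , t∈D , t≢u) → s∉D (src∈D e∈ t∈D t≢u)) , (λ (s∈D , _) → s∉D s∈D)))

    K-edge⁻ : ∀ {e} → e ∈ E K → e ∈ E G × (tgt G e ∈ D → src G e ∉ D × tgt G e ≡ u)
    K-edge⁻ {e} e∈ with ∈-comprehension⁻ (kept? G D u u∈D) e∈ | tgt G e ≟ u
    ... | e∈E , _      , ¬both | yes t≡u = e∈E , λ t∈D → (λ s∈D → ¬both (s∈D , t∈D)) , t≡u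
    ... | e∈E , ¬entry , ¬both | no  t≢u = e∈E , λ t∈D →
      contradiction ((λ s∈D → ¬both (s∈D , t∈D)) , t∈D , t≢u) ¬entry

    K-vertex⁺ : ∀ {x} → x ∈ V G → x ∉ D → x ∈ V K
    K-vertex⁺ x∈V x∉D = x∈p∪q⁺ (inj₁ (x∈p∧x∉q⇒x∈p─q x∈V x∉D))

    u∈K : u ∈ V K
    u∈K = x∈p∪q⁺ (inj₂ (x∈⁅x⁆ u))

    merge-∈ : ∀ {x} → x ∈ D → ⟨ x ⟩ ≡ u
    merge-∈ {x} x∈D with x ∈? D
    ... | yes _   = refl
    ... | no  x∉D = contradiction x∈D x∉D

    merge-fixed : ∀ {x} → (x ∈ D → x ≡ u) → ⟨ x ⟩ ≡ x
    merge-fixed {x} fix with x ∈? D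
    ... | yes x∈D = sym (fix x∈D)
    ... | no  _   = refl

    merge-v : ⟨ v ⟩ ≡ v
    merge-v = merge-fixed (sym ∘ v∈D⇒u≡v)

    -- A kept edge can enter `D` only at `u`, which merging fixes. So entry conditions carry over
    -- between `G` and `K`.
    merge-tgt : ∀ {e} → e ∈ E K → ⟨ tgt G e ⟩ ≡ tgt G e
    merge-tgt e∈ = merge-fixed (λ t∈D → proj₂ (proj₂ (K-edge⁻ e∈) t∈D))

    K-vertex⁻ : ∀ {x} → x ∈ V K → x ∈ V G × ⟨ x ⟩ ≡ x
    K-vertex⁻ {x} x∈ with x∈p∪q⁻ _ _ x∈
    ... | inj₂ x∈u with refl ← x∈⁅y⁆⇒x≡y u x∈u = u∈V , merge-∈ u∈D
    ... | inj₁ x∈V─D = p─q⊆p (V G) D x∈V─D , merge-fixed λ x∈D → contradiction x∈D (x∈p─q⇒x∉q (V G) D x∈V─D)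

    v∈K : v ∈ V K
    v∈K = subst (_∈ V K) merge-v (merge∈ G D u u∈D v∈V)

    u-noIncoming : ∀ {e} → e ∈ E H → tgt H e ≢ u
    u-noIncoming e∈ = let (_ , _ , _ , t≢u) = H-edge⁻ e∈ in t≢u

    v-noIncoming : ∀ {e} → e ∈ E K → tgt K e ≢ v
    v-noIncoming e∈ eq = noIncoming (proj₁ (K-edge⁻ e∈)) (trans (sym (merge-tgt e∈)) eq)

    disjoint : ∀ {e} → e ∈ E H → e ∉ E K
    disjoint e∈H e∈K = let (_ , s∈D , t∈D , _) = H-edge⁻ e∈H in
      proj₁ (proj₂ (K-edge⁻ e∈K) t∈D) s∈D

    -- Splitting an arborescence of `G`

    module Split {A : Subset m} (A⊆E : A ⊆ E G) (t : Tree (spanning G A A⊆E) v) where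

      T T₁ T₂ : Digraph n m
      T  = spanning G A A⊆E
      T₁ = spanning H (A ∩ E H) (p∩q⊆q A (E H))
      T₂ = spanning K (A ∩ E K) (p∩q⊆q A (E K))

      -- The tree path to the source of `e` has a prefix ending at `u`. If `e` entered `u`, the
      -- whole path followed by `e` would be a second, strictly longer tree path to `u`.
      no-return : ∀ {e} → e ∈ A → src G e ∈ D → tgt G e ≢ u
      no-return {e} e∈A s∈D t≡u =
        let (es , p) = reaches t (src∈V G (A⊆E e∈A))
            (fs , gs , q , es≡) = path-prefix p (proj₂ (∈-dom⁻ G v u s∈D) (spanning-path G p))
            fs≡ = unique-path (tree⇒uniquelyReachesAll t) u∈V q (subst (λ x → Path T v x _) t≡u (snocᵖ p e∈A))
        in too-long fs gs (trans fs≡ (cong (_∷ʳ e) es≡))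
        where
        too-long : ∀ (fs gs : List (Fin m)) {e} → fs ≢ (fs ++ gs) ∷ʳ e
        too-long []       []      ()
        too-long []       (_ ∷ _) ()
        too-long (_ ∷ fs) gs      eq = too-long fs gs (∷-injectiveʳ eq)

      A⊆H∪K : A ⊆ E H ∪ E K
      A⊆H∪K e∈A with K-edge⁺ (A⊆E e∈A)
      ... | inj₁ e∈K         = x∈p∪q⁺ (inj₂ e∈K)
      ... | inj₂ (s∈D , t∈D) = x∈p∪q⁺ (inj₁ (H-edge⁺ (A⊆E e∈A) s∈D t∈D (no-return e∈A s∈D)))

      H-tree : Tree T₁ u
      H-tree = record
        { reaches  = λ w∈ → let (w∈V , w∈D) = ∈-comprehension⁻ (inducedV? G D) w∈ in
            -- The invariant is vacuous outside `D`; whenever the path arrives at `u`, it restarts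
            -- from the empty path.
            path-invariant (λ x → x ∈ D → Reachable T₁ u x) step (proj₂ (reaches t w∈V))
              (λ v∈D → subst (Reachable T₁ u) (v∈D⇒u≡v v∈D) ([] , [])) w∈D
        ; noEntry  = u-noIncoming ∘ p∩q⊆q A (E H)
        ; oneEntry = λ e∈ f∈ → oneEntry t (p∩q⊆p A (E H) e∈) (p∩q⊆p A (E H) f∈)
        }
        where
        step : ∀ {e} → e ∈ A → (src G e ∈ D → Reachable T₁ u (src G e)) →
               tgt G e ∈ D → Reachable T₁ u (tgt G e)
        step {e} e∈A reach t∈D with tgt G e ≟ u
        ... | yes t≡u = subst (Reachable T₁ u) (sym t≡u) ([] , [])
        ... | no  t≢u = let s∈D = src∈D (A⊆E e∈A) t∈D t≢u in
          snocʳ (reach s∈D) (x∈p∩q⁺ (e∈A , H-edge⁺ (A⊆E e∈A) s∈D t∈D t≢u))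

      K-tree : Tree T₂ v
      K-tree = record
        { reaches  = λ w∈ → let (w∈V , ⟨w⟩≡w) = K-vertex⁻ w∈ in
            subst (Reachable T₂ v) ⟨w⟩≡w
              -- The image of the tree path under merging is followed: an edge inside `D` collapses
              -- and stays at `u`, any other edge is kept.
              (path-invariant (λ x → Reachable T₂ v ⟨ x ⟩) step (proj₂ (reaches t w∈V))
                (subst (Reachable T₂ v) (sym merge-v) ([] , [])))
        ; noEntry  = v-noIncoming ∘ p∩q⊆q A (E K)
        ; oneEntry = λ e∈ f∈ eq → oneEntry t (p∩q⊆p A (E K) e∈) (p∩q⊆p A (E K) f∈)
            (trans (sym (merge-tgt (p∩q⊆q A (E K) e∈))) (trans eq (merge-tgt (p∩q⊆q A (E K) f∈))))
        }
        where
        step : ∀ {e} → e ∈ A → Reachable T₂ v ⟨ src G e ⟩ → Reachable T₂ v ⟨ tgt G e ⟩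
        step e∈A reach with K-edge⁺ (A⊆E e∈A)
        ... | inj₁ e∈K         = snocʳ reach (x∈p∩q⁺ (e∈A , e∈K))
        ... | inj₂ (s∈D , t∈D) =
          subst (Reachable T₂ v) (trans (merge-∈ s∈D) (sym (merge-∈ t∈D))) reach

    split : ∀ {A} → IsArborescence G A →
            A ⊆ E H ∪ E K × IsArborescence H (A ∩ E H) × IsArborescence K (A ∩ E K)
    split {A} arbA =
        A⊆H∪K
      , tree⇒arborescence H (p∩q⊆q A (E H)) (H-vertex⁺ u∈D) H-tree
      , tree⇒arborescence K (p∩q⊆q A (E K)) v∈K K-tree
      where open Split (proj₁ arbA) (arborescence⇒tree G arbA v∈V noIncoming)

    -- Joining arborescences of `H` and `K`

    module Join {B C : Subset m} (B⊆E : B ⊆ E H) (C⊆E : C ⊆ E K)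
                (b : Tree (spanning H B B⊆E) u) (c : Tree (spanning K C C⊆E) v) where

      B∪C⊆E : B ∪ C ⊆ E G
      B∪C⊆E e∈ = [ (λ e∈B → proj₁ (H-edge⁻ (B⊆E e∈B))) , (λ e∈C → proj₁ (K-edge⁻ (C⊆E e∈C))) ]′
        (x∈p∪q⁻ B C e∈)

      T : Digraph n m
      T = spanning G (B ∪ C) B∪C⊆E

      u-reaches-D : ∀ {x} → x ∈ D → Reachable T u x
      u-reaches-D x∈D = path-invariant (Reachable T u)
        (λ e∈B reach → snocʳ reach (x∈p∪q⁺ (inj₁ e∈B))) (proj₂ (reaches b (H-vertex⁺ x∈D))) ([] , [])

      v-reaches-K : ∀ {x} → x ∈ V K → Reachable T v x
      v-reaches-K x∈K = path-invariant (Reachable T v) step (proj₂ (reaches c x∈K)) ([] , [])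
        where
        step : ∀ {e} → e ∈ C → Reachable T v ⟨ src G e ⟩ → Reachable T v ⟨ tgt G e ⟩
        step {e} e∈C reach = subst (Reachable T v) (sym (merge-tgt (C⊆E e∈C)))
          (snocʳ src-reachable (x∈p∪q⁺ (inj₂ e∈C)))
          where
          src-reachable : Reachable T v (src G e)
          src-reachable with src G e ∈? D
          -- In `K` the edge starts at the merged vertex `u`; edges of `B` lead from `u` to its true
          -- source in `D`.
          ... | yes s∈D = transʳ reach (u-reaches-D s∈D)
          ... | no  s∉D = reach

      -- Edges of `H` enter vertices of `D` other than `u`, whereas edges of `K` can enter `D` only
      -- at `u`.
      no-shared-target : ∀ {e f} → e ∈ B → f ∈ C → tgt G e ≢ tgt G f
      no-shared-target e∈B f∈C eq = let (_ , _ , t∈D , t≢u) = H-edge⁻ (B⊆E e∈B) in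
        t≢u (trans eq (proj₂ (proj₂ (K-edge⁻ (C⊆E f∈C)) (subst (_∈ D) eq t∈D))))

      tree : Tree T v
      tree = record
        { reaches  = reach
        ; noEntry  = noIncoming ∘ B∪C⊆E
        ; oneEntry = one
        }
        where
        reach : ∀ {w} → w ∈ V G → Reachable T v w
        reach {w} w∈V with w ∈? D
        ... | yes w∈D = transʳ (v-reaches-K u∈K) (u-reaches-D w∈D)
        ... | no  w∉D = v-reaches-K (K-vertex⁺ w∈V w∉D)

        one : ∀ {e f} → e ∈ B ∪ C → f ∈ B ∪ C → tgt G e ≡ tgt G f → e ≡ f
        one e∈ f∈ eq with x∈p∪q⁻ B C e∈ | x∈p∪q⁻ B C f∈
        ... | inj₁ e∈B | inj₁ f∈B = oneEntry b e∈B f∈B eq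
        ... | inj₁ e∈B | inj₂ f∈C = contradiction eq (no-shared-target e∈B f∈C)
        ... | inj₂ e∈C | inj₁ f∈B = contradiction (sym eq) (no-shared-target f∈B e∈C)
        -- Targets in `K` are the merged targets, hence the application of `⟨_⟩` to both sides.
        ... | inj₂ e∈C | inj₂ f∈C = oneEntry c e∈C f∈C (cong ⟨_⟩ eq)

    join : ∀ {B C} → IsArborescence H B → IsArborescence K C → IsArborescence G (B ∪ C)
    join arbB arbC = tree⇒arborescence G B∪C⊆E v∈V tree
      where
      open Join (proj₁ arbB) (proj₁ arbC)
        (arborescence⇒tree H arbB (H-vertex⁺ u∈D) u-noIncoming)
        (arborescence⇒tree K arbC v∈K v-noIncoming)

  κ-dom : κ G ≈ κ H *ᵖ κ K
  κ-dom = κ-factor G H K disjoint split join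

theorem4p2 : ∀ {n m : ℕ} (G : Digraph n m) (v : Fin n) → RootedAt G v →
    (u : Fin n) (u∈V : u ∈ V G) →
    let D = dom G v u in
    κ G ≈ κ (root u (induced G D)) *ᵖ κ (contract G D u (u∈dom G v u u∈V))
theorem4p2 = κ-dom
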